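{- Let $\overline{K}_{2,n}$ be any geometric realization of $K_{2,n}$. If the vertices of $\overline{K}_{2,n}$ are re-labeled by the re-labeling protocol described in the context, and $\pi\in S_n$ is the corresponding induced permutation, then $\overline{K}_{2,n}$ is geo-isomorphic to $\overline{K}_{2,n}(\pi)$.
   Context: A geometric graph is a simple graph together with a straight-line drawing in the plane with vertices in general position (no three vertices collinear, no three edges crossing at a single point). Two edges cross if they meet at a point interior to both. A geo-isomorphism $f:\overline{G}\to\overline{H}$ is a bijection $f:V(G)\to V(H)$ that preserves adjacency and non-adjacency ($uv\in E(G)\iff f(u)f(v)\in E(H)$) and crossings and non-crossings ($xy$ crosses $uv$ in $\overline G$ iff $f(x)f(y)$ crosses $f(u)f(v)$ in $\overline H$). The vertex set of $K_{2,n}$ is $\{a,b\}\cup\{1,\dots,n\}$, with $a$ and $b$ each adjacent to all of $1,\dots,n$. Realization $\overline{K}_{2,n}(\pi)$ for $\pi\in S_n$: from each of two points $a,b\in\mathbb{R}^2$ draw $n$ rays, all on the same side of the line $ab$, such that each ray from $a$ meets each ray from $b$ (and generic, so that general position holds). Label the rays from $b$ as $1,\dots,n$ in increasing order of the angle they make with the segment $ba$; label the rays from $a$ as $\pi(1),\dots,\pi(n)$ in increasing order of the angle they make with the segment $ab$. Place vertex $i$ at the intersection of the two rays labeled $i$, and draw the segments $ai$, $bi$ for all $i$. Re-labeling protocol: given a realization $\overline{K}_{2,n}$, the line through $a,b$ divides the plane into two half-planes. Choose one containing $t$ of the $n$ vertices other than $a,b$, with $0<t\le n$. Re-label these vertices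 $1,\dots,t$ so that, with $\theta_b(j)=\angle abj$, we have $0<\theta_b(1)<\dots<\theta_b(t)<180^\circ$. With $\theta_a(j)=\angle baj$, define $\pi$ on $\{1,\dots,t\}$ as the permutation of $\{1,\dots,t\}$ with $0<\theta_a(\pi(1))<\dots<\theta_a(\pi(t))<180^\circ$. If $t<n$, re-label the vertices in the other half-plane $t+1,\dots,n$ so that $0<\theta_b(t+1)<\dots<\theta_b(n)<180^\circ$, and define $\pi$ on $\{t+1,\dots,n\}$ as the permutation of that set with $0<\theta_a(\pi(t+1))<\dots<\theta_a(\pi(n))<180^\circ$. The resulting $\pi\in S_n$ is the induced permutation. -}

module Defs where

open import Level using (Level; _⊔_) renaming (suc to lsuc; zero to 0ℓ)
open import Algebra.Bundles using (CommutativeRing)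
open import Data.Nat.Base as ℕ using (ℕ)
open import Data.Fin.Base as Fin using (Fin; toℕ)
open import Data.Fin.Permutation using (Permutation′; _⟨$⟩ʳ_)
open import Data.Product.Base using (_×_; _,_; ∃-syntax)
open import Data.Sum.Base using (_⊎_)
open import Function.Bundles using (_⤖_; _⇔_; module Bijection)
open import Function.Definitions using (Injective)
open import Relation.Binary.Core using (Rel)
open import Relation.Binary.Definitions using (Symmetric; Irreflexive; tri<; tri≈; tri>)
open import Relation.Binary.Structures using (IsStrictTotalOrder)
open import Relation.Binary.PropositionalEquality.Core using (_≡_; _≢_; refl)
open import Relation.Nullary.Negation.Core using (¬_)

-- The standard library has no real numbers, so the plane is taken over an
-- arbitrary totally ordered field; ℝ (with classical logic) is an instance.

record OrderedField (c ℓ₁ ℓ₂ : Level) : Set (lsuc (c ⊔ ℓ₁ ⊔ ℓ₂)) where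
  infix 4 _<_
  field
    commutativeRing : CommutativeRing c ℓ₁
  open CommutativeRing commutativeRing public
  field
    _<_                : Rel Carrier ℓ₂
    isStrictTotalOrder : IsStrictTotalOrder _≈_ _<_
    0≉1                : ¬ 0# ≈ 1#
    inverse            : ∀ x → ¬ x ≈ 0# → ∃[ y ] x * y ≈ 1#
    +-monoˡ-<          : ∀ z {x y} → x < y → x + z < y + z
    *-pos              : ∀ {x y} → 0# < x → 0# < y → 0# < x * y

  open IsStrictTotalOrder isStrictTotalOrder public
    using (compare; <-resp-≈) renaming (trans to <-trans; irrefl to <-irrefl)

  infix 4 _≤_
  _≤_ : Rel Carrier (ℓ₁ ⊔ ℓ₂)
  x ≤ y = x < y ⊎ x ≈ y

  ∣_∣ : Carrier → Carrier
  ∣ x ∣ with compare x 0#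
  ... | tri< _ _ _ = - x
  ... | tri≈ _ _ _ = x
  ... | tri> _ _ _ = x

record SimpleGraph : Set₁ where
  field
    Vertex : Set
    Adj    : Rel Vertex 0ℓ
    sym    : Symmetric Adj
    irrefl : Irreflexive _≡_ Adj

-- The edges xy and uv, as unordered pairs, are distinct.
DistinctEdges : {V : Set} (x y u v : V) → Set
DistinctEdges x y u v = ¬ ((x ≡ u × y ≡ v) ⊎ (x ≡ v × y ≡ u))

data K₂-Vertex (n : ℕ) : Set where
  a b : K₂-Vertex n
  mid : Fin n → K₂-Vertex n

data K₂-Adj {n : ℕ} : Rel (K₂-Vertex n) 0ℓ where
  a–mid : ∀ i → K₂-Adj a (mid i)
  b–mid : ∀ i → K₂-Adj b (mid i)
  mid–a : ∀ i → K₂-Adj (mid i) a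
  mid–b : ∀ i → K₂-Adj (mid i) b

K₂ : ℕ → SimpleGraph
K₂ n = record
  { Vertex = K₂-Vertex n
  ; Adj    = K₂-Adj
  ; sym    = λ { (a–mid i) → mid–a i ; (b–mid i) → mid–b i
               ; (mid–a i) → a–mid i ; (mid–b i) → b–mid i }
  ; irrefl = λ { refl () }
  }

data Side : Set where
  left right : Side

opposite : Side → Side
opposite left  = right
opposite right = left

module _ {c ℓ₁ ℓ₂ : Level} (F : OrderedField c ℓ₁ ℓ₂) where
  open OrderedField F

  -- Points and vectors alike.
  record Point : Set c where
    constructor _,_
    field
      x-coord y-coord : Carrier

  open Point

  infix  4 _≈ₚ_
  infixl 6 _+ₚ_ _-ₚ_
  infixr 7 _·_

  _≈ₚ_ : Rel Point ℓ₁
  p ≈ₚ q = x-coord p ≈ x-coord q × y-coord p ≈ y-coord q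

  _+ₚ_ _-ₚ_ : Point → Point → Point
  (x , y) +ₚ (x′ , y′) = (x + x′) , (y + y′)
  (x , y) -ₚ (x′ , y′) = (x - x′) , (y - y′)

  _·_ : Carrier → Point → Point
  s · (x , y) = (s * x) , (s * y)

  dot cross : Point → Point → Carrier
  dot   (x , y) (x′ , y′) = x * x′ + y * y′
  cross (x , y) (x′ , y′) = x * y′ - y * x′

  -- r lies on the line through o with direction d.
  OnLine : (o d r : Point) → Set (c ⊔ ℓ₁)
  OnLine o d r = ∃[ s ] r ≈ₚ o +ₚ s · d

  Collinear : (p q r : Point) → Set (c ⊔ ℓ₁)
  Collinear p q r = ∃[ o ] ∃[ d ]
    ¬ (d ≈ₚ (0# , 0#)) × OnLine o d p × OnLine o d q × OnLine o d r

  -- r lies on the ray that starts at o and passes through q.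
  OnRay : (o q r : Point) → Set (c ⊔ ℓ₁ ⊔ ℓ₂)
  OnRay o q r = ∃[ s ] 0# ≤ s × r ≈ₚ o +ₚ s · (q -ₚ o)

  InteriorPoint : (p q r : Point) → Set (c ⊔ ℓ₁ ⊔ ℓ₂)
  InteriorPoint p q r = ∃[ s ] 0# < s × s < 1# × r ≈ₚ p +ₚ s · (q -ₚ p)

  -- The open half-planes bounded by the line pq.
  InHalfPlane : Side → (p q r : Point) → Set ℓ₂
  InHalfPlane left  p q r = 0# < cross (q -ₚ p) (r -ₚ p)
  InHalfPlane right p q r = cross (q -ₚ p) (r -ₚ p) < 0#

  -- An angle θ is represented by (ρ cos θ , ρ sin θ) for some ρ > 0, where
  -- 0° ≤ θ ≤ 180°.
  record Angle : Set c where
    constructor _,_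
    field
      cosine sine : Carrier

  -- The unoriented angle ∠pqr at q; here ρ = ∣qp∣ ∣qr∣.
  ∠ : (p q r : Point) → Angle
  ∠ p q r = dot (p -ₚ q) (r -ₚ q) , ∣ cross (p -ₚ q) (r -ₚ q) ∣

  0° 180° : Angle
  0°   = 1# , 0#
  180° = - 1# , 0#

  -- θ < φ iff sin (φ - θ) > 0.  This is the usual order as long as at least
  -- one of θ and φ lies strictly between 0° and 180°; the degenerate
  -- comparison of 0° with 180° is not needed.
  infix 4 _<∠_
  _<∠_ : Rel Angle ℓ₂
  (x , y) <∠ (x′ , y′) = x′ * y < x * y′

  record Realization (G : SimpleGraph) : Set (c ⊔ ℓ₁ ⊔ ℓ₂) where
    open SimpleGraph G using (Vertex; Adj)
    field
      pos          : Vertex → Point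
      injective    : Injective _≡_ _≈ₚ_ pos
      noCollinear  : ∀ {u v w} → u ≢ v → v ≢ w → u ≢ w →
                     ¬ Collinear (pos u) (pos v) (pos w)
      noConcurrent : ∀ {u u′ v v′ w w′} → Adj u u′ → Adj v v′ → Adj w w′ →
                     DistinctEdges u u′ v v′ → DistinctEdges v v′ w w′ →
                     DistinctEdges u u′ w w′ →
                     ¬ (∃[ p ] InteriorPoint (pos u) (pos u′) p
                             × InteriorPoint (pos v) (pos v′) p
                             × InteriorPoint (pos w) (pos w′) p)

    Crosses : (x y u v : Vertex) → Set (c ⊔ ℓ₁ ⊔ ℓ₂)
    Crosses x y u v = Adj x y × Adj u v × DistinctEdges x y u v ×
      (∃[ p ] InteriorPoint (pos x) (pos y) p × InteriorPoint (pos u) (pos v) p)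

  open Realization

  record GeoIsomorphism {G H : SimpleGraph}
                        (Ḡ : Realization G) (H̄ : Realization H)
                        : Set (c ⊔ ℓ₁ ⊔ ℓ₂) where
    private
      module G = SimpleGraph G
      module H = SimpleGraph H
    field
      bijection : G.Vertex ⤖ H.Vertex
    f : G.Vertex → H.Vertex
    f = Bijection.to bijection
    field
      adjacency : ∀ u v → G.Adj u v ⇔ H.Adj (f u) (f v)
      crossings : ∀ x y u v →
                  Crosses Ḡ x y u v ⇔ Crosses H̄ (f x) (f y) (f u) (f v)

  -- K̄ arises from π by the construction of K̄₂,ₙ(π), for some choice of rays.
  record IsRealizationOf {n : ℕ} (π : Permutation′ n) (K̄ : Realization (K₂ n))
                         : Set (c ⊔ ℓ₁ ⊔ ℓ₂) where
    private
      A = pos K̄ a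
      B = pos K̄ b
    field
      -- The rays labelled i from a and from b, each given by a point on it
      -- other than its origin.
      rayᵃ rayᵇ  : Fin n → Point
      side       : Side
      sideᵃ      : ∀ i → InHalfPlane side A B (rayᵃ i)
      sideᵇ      : ∀ i → InHalfPlane side A B (rayᵇ i)
      meet       : ∀ i j → ∃[ p ] OnRay A (rayᵃ i) p × OnRay B (rayᵇ j) p
      increasingᵇ : ∀ {i j} → i Fin.< j → ∠ A B (rayᵇ i) <∠ ∠ A B (rayᵇ j)
      increasingᵃ : ∀ {i j} → i Fin.< j →
                    ∠ B A (rayᵃ (π ⟨$⟩ʳ i)) <∠ ∠ B A (rayᵃ (π ⟨$⟩ʳ j))
      vertex     : ∀ i → OnRay A (rayᵃ i) (pos K̄ (mid i))
                       × OnRay B (rayᵇ i) (pos K̄ (mid i))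

  -- The permutation π is induced by some run of the protocol on K̄.  Labels
  -- start at 0, so that the labels 1,…,t are here those with toℕ i < t.
  record Induces {n : ℕ} (K̄ : Realization (K₂ n)) (π : Permutation′ n)
                 : Set (c ⊔ ℓ₁ ⊔ ℓ₂) where
    private
      A = pos K̄ a
      B = pos K̄ b
    field
      side    : Side
      t       : ℕ
      0<t     : 0 ℕ.< t
      t≤n     : t ℕ.≤ n
      -- The vertex with new label i is the one with old label relabel i.
      relabel : Permutation′ n

    newPos : Fin n → Point
    newPos i = pos K̄ (mid (relabel ⟨$⟩ʳ i))

    θᵇ : Fin n → Angle
    θᵇ j = ∠ A B (newPos j)

    θᵃ : Fin n → Angle
    θᵃ j = ∠ B A (newPos j)

    field
      chosen : ∀ i → toℕ i ℕ.< t → InHalfPlane side A B (newPos i)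
      other  : ∀ i → t ℕ.≤ toℕ i → InHalfPlane (opposite side) A B (newPos i)

      rangeᵇ : ∀ i → 0° <∠ θᵇ i × θᵇ i <∠ 180°
      rangeᵃ : ∀ i → 0° <∠ θᵃ i × θᵃ i <∠ 180°

      chosenᵇ : ∀ {i j} → i Fin.< j → toℕ j ℕ.< t → θᵇ i <∠ θᵇ j
      otherᵇ  : ∀ {i j} → i Fin.< j → t ℕ.≤ toℕ i → θᵇ i <∠ θᵇ j

      -- π permutes {1,…,t}, hence also {t+1,…,n}.
      π-chosen : ∀ i → toℕ i ℕ.< t ⇔ toℕ (π ⟨$⟩ʳ i) ℕ.< t
      chosenᵃ  : ∀ {i j} → i Fin.< j → toℕ j ℕ.< t →
                 θᵃ (π ⟨$⟩ʳ i) <∠ θᵃ (π ⟨$⟩ʳ j)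
      otherᵃ   : ∀ {i j} → i Fin.< j → t ℕ.≤ toℕ i →
                 θᵃ (π ⟨$⟩ʳ i) <∠ θᵃ (π ⟨$⟩ʳ j)

{-# OPTIONS --safe #-}
module Submission where

-- For P, Q on the same side of the line AB, the segments AP and BQ cross iff
-- P precedes Q in the order of angles at A and follows it in the order of
-- angles at B: both conditions are the sign of a cross product (AP × AQ and
-- BP × BQ), and Cramer's rule expresses the ratios in which the lines AP and
-- BQ divide each other through these two cross products.  Segments on
-- different sides of AB, or sharing an endpoint, do not cross.  Hence in both
-- realizations the edges a–i and b–j cross iff (i , j) is an inversion of π.

open import Defs
open import Algebra.Bundles using (CommutativeRing)
open import Algebra.Solver.Ring.AlmostCommutativeRing
  using (fromCommutativeRing; _-Raw-AlmostCommutative⟶_)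
import Algebra.Properties.Ring
import Algebra.Properties.Semiring.Mult.TCOptimised
import Algebra.Solver.Ring
open import Data.Empty using (⊥-elim)
open import Data.Fin.Base as Fin using (Fin; toℕ)
open import Data.Fin.Permutation using (Permutation′; _⟨$⟩ʳ_; _⟨$⟩ˡ_; inverseˡ; inverseʳ)
import Data.Fin.Properties as Fin
open import Data.Integer.Base as ℤ using (ℤ; +_; -[1+_])
import Data.Integer.Properties as ℤ
import Data.Maybe.Base as Maybe
open import Data.Nat.Base as ℕ using (ℕ; zero; suc)
import Data.Nat.Properties as ℕ
open import Data.Product.Base using (_×_; _,_; ∃-syntax; proj₁; proj₂)
open import Data.Sum.Base using (inj₁; inj₂)
open import Data.Unit.Base using (⊤)
open import Function.Base using (_∘_)
open import Function.Bundles using (_⇔_; mk⇔; module Equivalence; mk↔ₛ′)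
import Function.Properties.Equivalence as ⇔
open import Function.Properties.Inverse using (↔⇒⤖)
open import Level using (Level; _⊔_)
open import Relation.Binary.Definitions using (tri<; tri≈; tri>)
open import Relation.Binary.PropositionalEquality.Core as ≡ using (_≡_)
import Relation.Binary.Reasoning.Setoid
open import Relation.Nullary.Decidable using (Dec; dec⇒maybe; yes; no)
open import Relation.Nullary.Negation.Core using (¬_; contradiction)

open Equivalence using (to; from)

-- A ring solver with integer coefficients.

-- Integer coefficients, unlike coefficients in the ring itself, can be
-- compared, so this solver cancels opposite monomials.
module IntegerCoefficientSolver {c ℓ} (R : CommutativeRing c ℓ) where
  open CommutativeRing R
  open Algebra.Properties.Ring ring
  open Algebra.Properties.Semiring.Mult.TCOptimised semiring
    using (×-homo-+; ×1-homo-*) renaming (_×_ to _×′_)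
  open Relation.Binary.Reasoning.Setoid setoid

  ⟦_⟧ℤ : ℤ → Carrier
  ⟦ + n ⟧ℤ      = n ×′ 1#
  ⟦ -[1+ n ] ⟧ℤ = - (suc n ×′ 1#)

  cancel-+ˡ : ∀ x y z → (x + y) - (x + z) ≈ y - z
  cancel-+ˡ x y z = begin
    (x + y) - (x + z)      ≈⟨ +-cong (+-comm x y) (-‿anti-homo-+ x z) ⟩
    (y + x) + (- z - x)    ≈⟨ +-congˡ (+-comm (- z) (- x)) ⟩
    (y + x) + (- x - z)    ≈⟨ +-assoc y x (- x - z) ⟩
    y + (x + (- x - z))    ≈⟨ +-congˡ (+-assoc x (- x) (- z)) ⟨
    y + ((x - x) - z)      ≈⟨ +-congˡ (+-congʳ (-‿inverseʳ x)) ⟩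
    y + (0# - z)           ≈⟨ +-congˡ (+-identityˡ (- z)) ⟩
    y - z                  ∎

  -- This is the mixed-sign case of `+-homo`: the sum of a nonnegative and a negative integer is a
  -- `⊖` of naturals. A unit taken from both arguments cancels in the ring by `cancel-+ˡ`.
  ⊖-homo : ∀ m n → ⟦ m ℤ.⊖ n ⟧ℤ ≈ m ×′ 1# - n ×′ 1#
  ⊖-homo m zero = begin
    m ×′ 1#       ≈⟨ +-identityʳ (m ×′ 1#) ⟨
    m ×′ 1# + 0#  ≈⟨ +-congˡ -0#≈0# ⟨
    m ×′ 1# - 0#  ∎
  ⊖-homo zero (suc n) = sym (+-identityˡ _)
  ⊖-homo (suc m) (suc n) = begin
    ⟦ suc m ℤ.⊖ suc n ⟧ℤ                 ≡⟨ ≡.cong ⟦_⟧ℤ (ℤ.[1+m]⊖[1+n]≡m⊖n m n) ⟩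
    ⟦ m ℤ.⊖ n ⟧ℤ                         ≈⟨ ⊖-homo m n ⟩
    m ×′ 1# - n ×′ 1#                    ≈⟨ cancel-+ˡ 1# _ _ ⟨
    (1# + m ×′ 1#) - (1# + n ×′ 1#)      ≈⟨ +-cong (×-homo-+ 1# 1 m) (-‿cong (×-homo-+ 1# 1 n)) ⟨
    suc m ×′ 1# - suc n ×′ 1#            ∎

  +-homo : ∀ i j → ⟦ i ℤ.+ j ⟧ℤ ≈ ⟦ i ⟧ℤ + ⟦ j ⟧ℤ
  +-homo (+ m)    (+ n)    = ×-homo-+ 1# m n
  +-homo (+ m)    -[1+ n ] = ⊖-homo m (suc n)
  +-homo -[1+ m ] (+ n)    = trans (⊖-homo n (suc m)) (+-comm _ _)
  +-homo -[1+ m ] -[1+ n ] = begin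
    - (suc (suc (m ℕ.+ n)) ×′ 1#)        ≡⟨ ≡.cong (λ k → - (k ×′ 1#)) (≡.sym (ℕ.+-suc (suc m) n)) ⟩
    - ((suc m ℕ.+ suc n) ×′ 1#)          ≈⟨ -‿cong (×-homo-+ 1# (suc m) (suc n)) ⟩
    - (suc m ×′ 1# + suc n ×′ 1#)        ≈⟨ -‿+-comm _ _ ⟨
    - (suc m ×′ 1#) - suc n ×′ 1#        ∎

  -‿homo : ∀ i → ⟦ ℤ.- i ⟧ℤ ≈ - ⟦ i ⟧ℤ
  -‿homo (+ zero)  = sym -0#≈0#
  -‿homo (+ suc n) = refl
  -‿homo -[1+ n ]  = sym (-‿involutive _)

  pos-*-pos-homo : ∀ m n → ⟦ + m ℤ.* + n ⟧ℤ ≈ ⟦ + m ⟧ℤ * ⟦ + n ⟧ℤ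
  pos-*-pos-homo m n = begin
    ⟦ + m ℤ.* + n ⟧ℤ     ≡⟨ ≡.cong ⟦_⟧ℤ (ℤ.pos-* m n) ⟨
    (m ℕ.* n) ×′ 1#      ≈⟨ ×1-homo-* m n ⟩
    m ×′ 1# * n ×′ 1#    ∎

  pos-*-homo : ∀ m j → ⟦ + m ℤ.* j ⟧ℤ ≈ ⟦ + m ⟧ℤ * ⟦ j ⟧ℤ
  pos-*-homo m (+ n)    = pos-*-pos-homo m n
  pos-*-homo m -[1+ n ] = begin
    ⟦ + m ℤ.* (ℤ.- + suc n) ⟧ℤ     ≡⟨ ≡.cong ⟦_⟧ℤ (ℤ.neg-distribʳ-* (+ m) (+ suc n)) ⟨
    ⟦ ℤ.- (+ m ℤ.* + suc n) ⟧ℤ     ≈⟨ -‿homo (+ m ℤ.* + suc n) ⟩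
    - ⟦ + m ℤ.* + suc n ⟧ℤ         ≈⟨ -‿cong (pos-*-pos-homo m (suc n)) ⟩
    - (m ×′ 1# * suc n ×′ 1#)      ≈⟨ -‿distribʳ-* _ _ ⟩
    m ×′ 1# * - (suc n ×′ 1#)      ∎

  *-homo : ∀ i j → ⟦ i ℤ.* j ⟧ℤ ≈ ⟦ i ⟧ℤ * ⟦ j ⟧ℤ
  *-homo (+ m)    j = pos-*-homo m j
  *-homo -[1+ m ] j = begin
    ⟦ (ℤ.- + suc m) ℤ.* j ⟧ℤ       ≡⟨ ≡.cong ⟦_⟧ℤ (ℤ.neg-distribˡ-* (+ suc m) j) ⟨
    ⟦ ℤ.- (+ suc m ℤ.* j) ⟧ℤ       ≈⟨ -‿homo (+ suc m ℤ.* j) ⟩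
    - ⟦ + suc m ℤ.* j ⟧ℤ           ≈⟨ -‿cong (pos-*-homo (suc m) j) ⟩
    - (suc m ×′ 1# * ⟦ j ⟧ℤ)       ≈⟨ -‿distribˡ-* _ _ ⟩
    - (suc m ×′ 1#) * ⟦ j ⟧ℤ       ∎

  morphism : ℤ.+-*-rawRing -Raw-AlmostCommutative⟶ fromCommutativeRing R
  morphism = record
    { ⟦_⟧    = ⟦_⟧ℤ
    ; +-homo = +-homo
    ; *-homo = *-homo
    ; -‿homo = -‿homo
    ; 0-homo = refl
    ; 1-homo = refl
    }

  open Algebra.Solver.Ring ℤ.+-*-rawRing (fromCommutativeRing R) morphism
    (λ i j → Maybe.map (λ i≡j → reflexive (≡.cong ⟦_⟧ℤ i≡j)) (dec⇒maybe (i ℤ.≟ j))) public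
    using (Polynomial; solve; con; _:+_; _:-_; _:*_; :-_; _:=_)

-- Signs, squares and absolute values in an ordered field.

module OrderedFieldProperties {c ℓ₁ ℓ₂} (F : OrderedField c ℓ₁ ℓ₂) where
  open OrderedField F
  open IntegerCoefficientSolver commutativeRing
  open Algebra.Properties.Ring ring using (-‿involutive)

  <-respˡ : ∀ {x y z} → x ≈ y → x < z → y < z
  <-respˡ = proj₂ <-resp-≈

  <-respʳ : ∀ {x y z} → x ≈ y → z < x → z < y
  <-respʳ = proj₁ <-resp-≈

  <-asym : ∀ {x y} → x < y → ¬ y < x
  <-asym x<y y<x = <-irrefl refl (<-trans x<y y<x)

  x<y⇒0<y-x : ∀ {x y} → x < y → 0# < y - x
  x<y⇒0<y-x {x} x<y = <-respˡ (-‿inverseʳ x) (+-monoˡ-< (- x) x<y)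

  0<y-x⇒x<y : ∀ {x y} → 0# < y - x → x < y
  0<y-x⇒x<y {x} {y} 0<y-x =
    <-respˡ (+-identityˡ x)
      (<-respʳ (solve 2 (λ x y → (y :- x) :+ x := y) refl x y) (+-monoˡ-< x 0<y-x))

  x<0⇒0<-x : ∀ {x} → x < 0# → 0# < - x
  x<0⇒0<-x {x} x<0 = <-respʳ (+-identityˡ (- x)) (x<y⇒0<y-x x<0)

  0<x⇒-x<0 : ∀ {x} → 0# < x → - x < 0#
  0<x⇒-x<0 {x} 0<x =
    0<y-x⇒x<y (<-respʳ (trans (sym (-‿involutive x)) (sym (+-identityˡ _))) 0<x)

  +-nonneg-pos : ∀ {x y} → 0# ≤ x → 0# < y → 0# < x + y
  +-nonneg-pos {x} {y} (inj₁ 0<x) 0<y =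
    <-trans 0<y (<-respˡ (+-identityˡ y) (+-monoˡ-< y 0<x))
  +-nonneg-pos {x} {y} (inj₂ 0≈x) 0<y =
    <-respʳ (trans (sym (+-identityˡ y)) (+-congʳ 0≈x)) 0<y

  +-pos-nonneg : ∀ {x y} → 0# < x → 0# ≤ y → 0# < x + y
  +-pos-nonneg {x} {y} 0<x 0≤y = <-respʳ (+-comm y x) (+-nonneg-pos 0≤y 0<x)

  -- Lets a positive factor, such as a squared length, be dropped without inverting it.
  *-cancelˡ-pos : ∀ {x y} → 0# < x → 0# < x * y → 0# < y
  *-cancelˡ-pos {x} {y} 0<x 0<xy with compare y 0#
  ... | tri> _ _ 0<y = 0<y
  ... | tri≈ _ y≈0 _ = contradiction 0<xy (<-irrefl (sym (trans (*-congˡ y≈0) (zeroʳ x))))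
  ... | tri< y<0 _ _ = contradiction 0<xy (<-asym xy<0)
    where
    xy<0 : x * y < 0#
    xy<0 = <-respˡ (solve 2 (λ x y → :- (x :* (:- y)) := x :* y) refl x y)
             (0<x⇒-x<0 (*-pos 0<x (x<0⇒0<-x y<0)))

  x*x-pos : ∀ {x} → ¬ x ≈ 0# → 0# < x * x
  x*x-pos {x} x≉0 with compare x 0#
  ... | tri> _ _ 0<x = *-pos 0<x 0<x
  ... | tri≈ _ x≈0 _ = contradiction x≈0 x≉0
  ... | tri< x<0 _ _ =
    <-respʳ (solve 1 (λ x → (:- x) :* (:- x) := x :* x) refl x)
      (*-pos (x<0⇒0<-x x<0) (x<0⇒0<-x x<0))

  x*x-nonneg : ∀ x → 0# ≤ x * x
  x*x-nonneg x with compare x 0#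
  ... | tri< _ x≉0 _ = inj₁ (x*x-pos x≉0)
  ... | tri≈ _ x≈0 _ = inj₂ (sym (trans (*-congʳ x≈0) (zeroˡ x)))
  ... | tri> _ x≉0 _ = inj₁ (x*x-pos x≉0)

  0<1 : 0# < 1#
  0<1 = <-respʳ (*-identityˡ 1#) (x*x-pos (0≉1 ∘ sym))

  ∣x∣≈x : ∀ {x} → ¬ x < 0# → ∣ x ∣ ≈ x
  ∣x∣≈x {x} x≮0 with compare x 0#
  ... | tri< x<0 _ _ = contradiction x<0 x≮0
  ... | tri≈ _ _ _   = refl
  ... | tri> _ _ _   = refl

  ∣x∣≈-x : ∀ {x} → x < 0# → ∣ x ∣ ≈ - x
  ∣x∣≈-x {x} x<0 with compare x 0#
  ... | tri< _ _ _   = refl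
  ... | tri≈ x≮0 _ _ = contradiction x<0 x≮0
  ... | tri> x≮0 _ _ = contradiction x<0 x≮0

  -- A positive factor preserves the sign, so the sign of `x` decides how `∣ y ∣` evaluates.
  ∣∣-scale : ∀ {s x y} → 0# < s → y ≈ s * x → ∣ y ∣ ≈ s * ∣ x ∣
  ∣∣-scale {s} {x} {y} 0<s y≈sx with compare x 0#
  ... | tri< x<0 _ _ = trans (∣x∣≈-x y<0) (trans (-‿cong y≈sx)
      (solve 2 (λ s x → :- (s :* x) := s :* (:- x)) refl s x))
    where
    y<0 : y < 0#
    y<0 = <-respˡ (trans (solve 2 (λ s x → :- (s :* (:- x)) := s :* x) refl s x) (sym y≈sx))
            (0<x⇒-x<0 (*-pos 0<s (x<0⇒0<-x x<0)))
  ... | tri≈ _ x≈0 _ =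
    trans (∣x∣≈x λ y<0 → <-irrefl (trans y≈sx (trans (*-congˡ x≈0) (zeroʳ s))) y<0) y≈sx
  ... | tri> _ _ 0<x =
    trans (∣x∣≈x λ y<0 → <-asym y<0 (<-respʳ (sym y≈sx) (*-pos 0<s 0<x))) y≈sx

  inverse-pos : ∀ {x y} → 0# < x → x * y ≈ 1# → 0# < y
  inverse-pos 0<x xy≈1 = *-cancelˡ-pos 0<x (<-respʳ (sym xy≈1) 0<1)

-- The two sides of a line.

opposite-injective : ∀ {side side′} → opposite side ≡ opposite side′ → side ≡ side′
opposite-injective {left}  {left}  _ = ≡.refl
opposite-injective {right} {right} _ = ≡.refl

side≢opposite : ∀ side → ¬ side ≡ opposite side
side≢opposite left  ()
side≢opposite right ()

-- Vectors, cross products and half-planes.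

module PlaneGeometry {c ℓ₁ ℓ₂} (F : OrderedField c ℓ₁ ℓ₂) where
  open OrderedField F
  open OrderedFieldProperties F
  open IntegerCoefficientSolver commutativeRing
  open Algebra.Properties.Ring ring using (x∙y⁻¹≈ε⇒x≈y)
  open Relation.Binary.Reasoning.Setoid setoid

  infix 8 _⟶_

  _⟶_ : Point F → Point F → Point F
  A ⟶ B = _-ₚ_ F B A

  at : Point F → Carrier → Point F → Point F
  at A s P = _+ₚ_ F A (_·_ F s (A ⟶ P))

  private
    :cross :dot : ∀ {n} (x y x′ y′ : Polynomial n) → Polynomial n
    :cross x y x′ y′ = x :* y′ :- y :* x′
    :dot   x y x′ y′ = x :* x′ :+ y :* y′

  cross-congˡ : ∀ {p p′} q → _≈ₚ_ F p p′ → cross F p q ≈ cross F p′ q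
  cross-congˡ _ (x≈x′ , y≈y′) = +-cong (*-congʳ x≈x′) (-‿cong (*-congʳ y≈y′))

  cross-congʳ : ∀ p {q q′} → _≈ₚ_ F q q′ → cross F p q ≈ cross F p q′
  cross-congʳ _ (x≈x′ , y≈y′) = +-cong (*-congˡ y≈y′) (-‿cong (*-congˡ x≈x′))

  dot-congʳ : ∀ p {q q′} → _≈ₚ_ F q q′ → dot F p q ≈ dot F p q′
  dot-congʳ _ (x≈x′ , y≈y′) = +-cong (*-congˡ x≈x′) (*-congˡ y≈y′)

  ⟶-cong : ∀ A {P Q} → _≈ₚ_ F P Q → _≈ₚ_ F (A ⟶ P) (A ⟶ Q)
  ⟶-cong _ (x≈x′ , y≈y′) = +-congʳ x≈x′ , +-congʳ y≈y′

  -- The cross product is twice the signed area of the triangle ABP, and exchanging A and B reverses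
  -- its orientation.
  cross-reverse : ∀ A B P → cross F (B ⟶ A) (B ⟶ P) ≈ - cross F (A ⟶ B) (A ⟶ P)
  cross-reverse (ax , ay) (bx , by) (px , py) =
    solve 6 (λ ax ay bx by px py →
      :cross (ax :- bx) (ay :- by) (px :- bx) (py :- by)
        := :- :cross (bx :- ax) (by :- ay) (px :- ax) (py :- ay))
      refl ax ay bx by px py

  reverse-half-plane : ∀ side {A B P} →
                       InHalfPlane F side A B P → InHalfPlane F (opposite side) B A P
  reverse-half-plane left {A} {B} {P} 0<h =
    <-respˡ (sym (cross-reverse A B P)) (0<x⇒-x<0 0<h)
  reverse-half-plane right {A} {B} {P} h<0 =
    <-respʳ (sym (cross-reverse A B P)) (x<0⇒0<-x h<0)

  -- The nonzero cross product forces some coordinate of `u` to be nonzero, and a sum of two squares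
  -- is positive as soon as one of them is.
  dot-self-pos : ∀ {u} p → ¬ cross F u p ≈ 0# → 0# < dot F u u
  dot-self-pos {ux , uy} (px , py) cross≉0 with compare ux 0# | compare uy 0#
  ... | tri< _ ux≉0 _ | _             = +-pos-nonneg (x*x-pos ux≉0) (x*x-nonneg uy)
  ... | tri> _ ux≉0 _ | _             = +-pos-nonneg (x*x-pos ux≉0) (x*x-nonneg uy)
  ... | _             | tri< _ uy≉0 _ = +-nonneg-pos (x*x-nonneg ux) (x*x-pos uy≉0)
  ... | _             | tri> _ uy≉0 _ = +-nonneg-pos (x*x-nonneg ux) (x*x-pos uy≉0)
  ... | tri≈ _ ux≈0 _ | tri≈ _ uy≈0 _ = contradiction cross≈0 cross≉0
    where
    cross≈0 : ux * py - uy * px ≈ 0#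
    cross≈0 = begin
      ux * py - uy * px  ≈⟨ +-cong (*-congʳ ux≈0) (-‿cong (*-congʳ uy≈0)) ⟩
      0# * py - 0# * px  ≈⟨ solve 2 (λ px py → con (+ 0) :* py :- con (+ 0) :* px := con (+ 0)) refl px py ⟩
      0#                 ∎

  -- Comparison of angles by cross products.

  angle : (u p : Point F) → Angle F
  angle u p = dot F u p , ∣ cross F u p ∣

  -- The subtraction formula for the sine, multiplied by the lengths involved: if `p` and `q` make
  -- angles θ and φ with `u`, both sides equal ∣u∣² ∣p∣ ∣q∣ sin (φ - θ).
  dot-cross-identity : ∀ u p q →
    dot F u p * cross F u q - dot F u q * cross F u p ≈ dot F u u * cross F p q
  dot-cross-identity (ux , uy) (px , py) (qx , qy) =
    solve 6 (λ ux uy px py qx qy →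
      :dot ux uy px py :* :cross ux uy qx qy :- :dot ux uy qx qy :* :cross ux uy px py
        := :dot ux uy ux uy :* :cross px py qx qy)
      refl ux uy px py qx qy

  -- To the left of `u` the absolute values change nothing, so the difference that defines `<∠` is
  -- the positive number `dot F u u` times `cross F p q`.
  angle-<-left : ∀ {u p q} → 0# < cross F u p → 0# < cross F u q →
                 _<∠_ F (angle u p) (angle u q) ⇔ 0# < cross F p q
  angle-<-left {u} {p} {q} 0<h 0<k = mk⇔
    (λ θ<φ → *-cancelˡ-pos 0<u² (<-respʳ difference (x<y⇒0<y-x θ<φ)))
    (λ 0<d → 0<y-x⇒x<y (<-respʳ (sym difference) (*-pos 0<u² 0<d)))
    where
    0<u² : 0# < dot F u u
    0<u² = dot-self-pos p (λ h≈0 → <-irrefl (sym h≈0) 0<h)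
    difference : dot F u p * ∣ cross F u q ∣ - dot F u q * ∣ cross F u p ∣
                   ≈ dot F u u * cross F p q
    difference = trans
      (+-cong (*-congˡ (∣x∣≈x (<-asym 0<k))) (-‿cong (*-congˡ (∣x∣≈x (<-asym 0<h)))))
      (dot-cross-identity u p q)

  -- To the right of `u` the absolute values negate both sines, which exchanges the roles of `p` and
  -- `q` in the identity.
  angle-<-right : ∀ {u p q} → cross F u p < 0# → cross F u q < 0# →
                  _<∠_ F (angle u p) (angle u q) ⇔ 0# < cross F q p
  angle-<-right {u} {p} {q} h<0 k<0 = mk⇔
    (λ θ<φ → *-cancelˡ-pos 0<u² (<-respʳ difference (x<y⇒0<y-x θ<φ)))
    (λ 0<d → 0<y-x⇒x<y (<-respʳ (sym difference) (*-pos 0<u² 0<d)))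
    where
    0<u² : 0# < dot F u u
    0<u² = dot-self-pos p (λ h≈0 → <-irrefl h≈0 h<0)
    difference : dot F u p * ∣ cross F u q ∣ - dot F u q * ∣ cross F u p ∣
                   ≈ dot F u u * cross F q p
    difference = begin
      dot F u p * ∣ cross F u q ∣ - dot F u q * ∣ cross F u p ∣
        ≈⟨ +-cong (*-congˡ (∣x∣≈-x k<0)) (-‿cong (*-congˡ (∣x∣≈-x h<0))) ⟩
      dot F u p * - cross F u q - dot F u q * - cross F u p
        ≈⟨ solve 4 (λ d e h k → d :* (:- k) :- e :* (:- h) := e :* h :- d :* k) refl
             (dot F u p) (dot F u q) (cross F u p) (cross F u q) ⟩
      dot F u q * cross F u p - dot F u p * cross F u q
        ≈⟨ dot-cross-identity u q p ⟩
      dot F u u * cross F q p ∎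

  <∠-asym : ∀ {θ φ} → _<∠_ F θ φ → ¬ _<∠_ F φ θ
  <∠-asym {x , y} {x′ , y′} θ<φ φ<θ = <-asym θ<φ φ<θ

  <∠-irrefl : ∀ {θ} → ¬ _<∠_ F θ θ
  <∠-irrefl = <-irrefl refl

  -- Passage from a point of a ray to another.

  -- An `Angle` represents its direction only up to a positive factor. Rescaling the two angles
  -- multiplies the difference that defines `<∠` by `s * t`, so its sign stays the same.
  <∠-scale : ∀ {s t x₁ y₁ x₂ y₂ x₁′ y₁′ x₂′ y₂′} → 0# < s → 0# < t →
             x₁′ ≈ s * x₁ → y₁′ ≈ s * y₁ → x₂′ ≈ t * x₂ → y₂′ ≈ t * y₂ →
             _<∠_ F (x₁ , y₁) (x₂ , y₂) → _<∠_ F (x₁′ , y₁′) (x₂′ , y₂′)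
  <∠-scale {s} {t} {x₁} {y₁} {x₂} {y₂} 0<s 0<t ex₁ ey₁ ex₂ ey₂ θ<φ =
    0<y-x⇒x<y (<-respʳ difference (*-pos (*-pos 0<s 0<t) (x<y⇒0<y-x θ<φ)))
    where
    difference = trans
      (solve 6 (λ s t x₁ y₁ x₂ y₂ →
         (s :* t) :* (x₁ :* y₂ :- x₂ :* y₁)
           := (s :* x₁) :* (t :* y₂) :- (t :* x₂) :* (s :* y₁))
         refl s t x₁ y₁ x₂ y₂)
      (sym (+-cong (*-cong ex₁ ey₂) (-‿cong (*-cong ex₂ ey₁))))

  cross-at : ∀ u A s P → cross F u (A ⟶ at A s P) ≈ s * cross F u (A ⟶ P)
  cross-at (ux , uy) (ax , ay) s (px , py) =
    solve 7 (λ ux uy ax ay s px py →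
      :cross ux uy ((ax :+ s :* (px :- ax)) :- ax) ((ay :+ s :* (py :- ay)) :- ay)
        := s :* :cross ux uy (px :- ax) (py :- ay))
      refl ux uy ax ay s px py

  dot-at : ∀ u A s P → dot F u (A ⟶ at A s P) ≈ s * dot F u (A ⟶ P)
  dot-at (ux , uy) (ax , ay) s (px , py) =
    solve 7 (λ ux uy ax ay s px py →
      :dot ux uy ((ax :+ s :* (px :- ax)) :- ax) ((ay :+ s :* (py :- ay)) :- ay)
        := s :* :dot ux uy (px :- ax) (py :- ay))
      refl ux uy ax ay s px py

  at-zero : ∀ A {s} P → s ≈ 0# → _≈ₚ_ F (at A s P) A
  at-zero (ax , ay) (px , py) s≈0 = lemma ax px , lemma ay py
    where
    lemma : ∀ x y → x + _ * (y - x) ≈ x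
    lemma x y = trans (+-congˡ (trans (*-congʳ s≈0) (zeroˡ _))) (+-identityʳ x)

  -- `OnRay` admits the parameter 0, but this would place `P` at the origin of the ray.
  ray-parameter-pos : ∀ {A R P} → ¬ _≈ₚ_ F P A → OnRay F A R P →
                      ∃[ s ] 0# < s × _≈ₚ_ F P (at A s R)
  ray-parameter-pos         P≉A (s , inj₁ 0<s , P≈)   = s , 0<s , P≈
  ray-parameter-pos {A} {R} P≉A (s , inj₂ 0≈s , (px≈ , py≈)) =
    contradiction (trans px≈ (proj₁ A≈) , trans py≈ (proj₂ A≈)) P≉A
    where A≈ = at-zero A R (sym 0≈s)

  -- The construction orders the rays by arbitrary points on them; this carries the order over to
  -- the vertices placed on those rays. Moving along a ray scales both `dot` and `cross` by the same
  -- positive parameter.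
  ray-angle-< : ∀ u {A R S P Q} → ¬ _≈ₚ_ F P A → ¬ _≈ₚ_ F Q A →
                OnRay F A R P → OnRay F A S Q →
                _<∠_ F (angle u (A ⟶ R)) (angle u (A ⟶ S)) →
                _<∠_ F (angle u (A ⟶ P)) (angle u (A ⟶ Q))
  ray-angle-< u {A} {R} {S} P≉A Q≉A P∈R Q∈S θ<φ
    with s , 0<s , P≈ ← ray-parameter-pos P≉A P∈R
       | t , 0<t , Q≈ ← ray-parameter-pos Q≉A Q∈S =
    <∠-scale 0<s 0<t
      (trans (dot-congʳ u (⟶-cong A P≈)) (dot-at u A s R))
      (∣∣-scale 0<s (trans (cross-congʳ u (⟶-cong A P≈)) (cross-at u A s R)))
      (trans (dot-congʳ u (⟶-cong A Q≈)) (dot-at u A t S))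
      (∣∣-scale 0<t (trans (cross-congʳ u (⟶-cong A Q≈)) (cross-at u A t S)))
      θ<φ

  half-plane-scale : ∀ side {A B R P s} → 0# < s → _≈ₚ_ F P (at A s R) →
                     InHalfPlane F side A B R → InHalfPlane F side A B P
  half-plane-scale side {A} {B} {R} {P} {s} 0<s P≈ = go side
    where
    scaled : cross F (A ⟶ B) (A ⟶ P) ≈ s * cross F (A ⟶ B) (A ⟶ R)
    scaled = trans (cross-congʳ (A ⟶ B) (⟶-cong A P≈)) (cross-at (A ⟶ B) A s R)
    go : ∀ side → InHalfPlane F side A B R → InHalfPlane F side A B P
    go left  0<h = <-respʳ (sym scaled) (*-pos 0<s 0<h)
    go right h<0 = <-respˡ
      (trans (solve 2 (λ s h → :- (s :* (:- h)) := s :* h) refl s _) (sym scaled))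
      (0<x⇒-x<0 (*-pos 0<s (x<0⇒0<-x h<0)))

  ray-half-plane : ∀ side {A B R P} → ¬ _≈ₚ_ F P A → OnRay F A R P →
                   InHalfPlane F side A B R → InHalfPlane F side A B P
  ray-half-plane side {A} {B} {R} {P} P≉A P∈R
    with s , 0<s , P≈ ← ray-parameter-pos P≉A P∈R = half-plane-scale side {A} {B} {R} {P} 0<s P≈

  -- Crossing of segments from the two ends of AB.

  Meet : (A P B Q : Point F) → Set (c ⊔ ℓ₁ ⊔ ℓ₂)
  Meet A P B Q = ∃[ X ] InteriorPoint F A P X × InteriorPoint F B Q X

  Meet-swap : ∀ {A P B Q} → Meet A P B Q → Meet B Q A P
  Meet-swap (X , X∈AP , X∈BQ) = X , X∈BQ , X∈AP

  interior-reverse : ∀ {P Q X} → InteriorPoint F P Q X → InteriorPoint F Q P X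
  interior-reverse {px , py} {qx , qy} (s , 0<s , s<1 , x≈ , y≈) =
    1# - s , x<y⇒0<y-x s<1
           , 0<y-x⇒x<y (<-respʳ (solve 1 (λ s → s := con (+ 1) :- (con (+ 1) :- s)) refl s) 0<s)
           , trans x≈ (swap px qx) , trans y≈ (swap py qy)
    where
    swap : ∀ x y → x + s * (y - x) ≈ y + (1# - s) * (x - y)
    swap = solve 3 (λ s x y →
      x :+ s :* (y :- x) := y :+ (con (+ 1) :- s) :* (x :- y)) refl s

  -- The point at which the segments AP and BQ meet divides them in the ratios
  -- cross AB AQ / D and cross AB AP / D, where D = cross AP BQ.
  meet-cross : ∀ {A P B Q} → InHalfPlane F left A B P → InHalfPlane F left A B Q →
               Meet A P B Q ⇔
               (0# < cross F (A ⟶ P) (A ⟶ Q) × 0# < cross F (B ⟶ P) (B ⟶ Q))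
  meet-cross {A} {P} {B} {Q} 0<h 0<k = mk⇔ meet⇒cross cross⇒meet
    where
    ax = Point.x-coord A
    ay = Point.y-coord A
    bx = Point.x-coord B
    by = Point.y-coord B
    px = Point.x-coord P
    py = Point.y-coord P
    qx = Point.x-coord Q
    qy = Point.y-coord Q
    h = cross F (A ⟶ B) (A ⟶ P)
    k = cross F (A ⟶ B) (A ⟶ Q)
    D = cross F (A ⟶ P) (B ⟶ Q)

    -- For positive `D`, the ratio `h / D` is below 1 iff `D - h` is positive. This difference and
    -- `D - k` are the cross products at A and at B, which is how the bounds on the parameters
    -- become the two conditions.
    D-h : D - h ≈ cross F (A ⟶ P) (A ⟶ Q)
    D-h = solve 8 (λ ax ay bx by px py qx qy →
      :cross (px :- ax) (py :- ay) (qx :- bx) (qy :- by)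
        :- :cross (bx :- ax) (by :- ay) (px :- ax) (py :- ay)
        := :cross (px :- ax) (py :- ay) (qx :- ax) (qy :- ay))
      refl ax ay bx by px py qx qy

    D-k : D - k ≈ cross F (B ⟶ P) (B ⟶ Q)
    D-k = solve 8 (λ ax ay bx by px py qx qy →
      :cross (px :- ax) (py :- ay) (qx :- bx) (qy :- by)
        :- :cross (bx :- ax) (by :- ay) (qx :- ax) (qy :- ay)
        := :cross (px :- bx) (py :- by) (qx :- bx) (qy :- by))
      refl ax ay bx by px py qx qy

    complement : ∀ {s z} → s < 1# → 0# < D → s * D ≈ z → 0# < D - z
    complement {s} s<1 0<D sD≈z = <-respʳ
      (trans (solve 2 (λ s d → (con (+ 1) :- s) :* d := d :- s :* d) refl s D)
             (+-congˡ (-‿cong sD≈z)))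
      (*-pos (x<y⇒0<y-x s<1) 0<D)

    meet⇒cross : Meet A P B Q →
                 0# < cross F (A ⟶ P) (A ⟶ Q) × 0# < cross F (B ⟶ P) (B ⟶ Q)
    meet⇒cross (X , (s , 0<s , s<1 , X≈s) , (r , 0<r , r<1 , X≈r)) =
        <-respʳ D-h (complement r<1 0<D rD≈h)
      , <-respʳ D-k (complement s<1 0<D sD≈k)
      where
      -- The cross product of AX with BQ is computed twice. With X on AP it is `s * D`; with X on BQ
      -- the part of AX along BQ drops out and `k` remains. The same is done below for AP with BX.
      sD≈k : s * D ≈ k
      sD≈k = begin
        s * D
          ≈⟨ solve 7 (λ ax ay px py ux uy s →
               s :* :cross (px :- ax) (py :- ay) ux uy
                 := :cross ((ax :+ s :* (px :- ax)) :- ax) ((ay :+ s :* (py :- ay)) :- ay) ux uy)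
               refl ax ay px py (qx - bx) (qy - by) s ⟩
        cross F (A ⟶ at A s P) (B ⟶ Q)
          ≈⟨ cross-congˡ (B ⟶ Q) (⟶-cong A X≈s) ⟨
        cross F (A ⟶ X) (B ⟶ Q)
          ≈⟨ cross-congˡ (B ⟶ Q) (⟶-cong A X≈r) ⟩
        cross F (A ⟶ at B r Q) (B ⟶ Q)
          ≈⟨ solve 7 (λ ax ay bx by qx qy r →
               :cross ((bx :+ r :* (qx :- bx)) :- ax) ((by :+ r :* (qy :- by)) :- ay) (qx :- bx) (qy :- by)
                 := :cross (bx :- ax) (by :- ay) (qx :- ax) (qy :- ay))
               refl ax ay bx by qx qy r ⟩
        k ∎
      rD≈h : r * D ≈ h
      rD≈h = begin
        r * D
          ≈⟨ solve 7 (λ bx by qx qy ux uy r →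
               r :* :cross ux uy (qx :- bx) (qy :- by)
                 := :cross ux uy ((bx :+ r :* (qx :- bx)) :- bx) ((by :+ r :* (qy :- by)) :- by))
               refl bx by qx qy (px - ax) (py - ay) r ⟩
        cross F (A ⟶ P) (B ⟶ at B r Q)
          ≈⟨ cross-congʳ (A ⟶ P) (⟶-cong B X≈r) ⟨
        cross F (A ⟶ P) (B ⟶ X)
          ≈⟨ cross-congʳ (A ⟶ P) (⟶-cong B X≈s) ⟩
        cross F (A ⟶ P) (B ⟶ at A s P)
          ≈⟨ solve 7 (λ ax ay bx by px py s →
               :cross (px :- ax) (py :- ay) ((ax :+ s :* (px :- ax)) :- bx) ((ay :+ s :* (py :- ay)) :- by)
                 := :cross (bx :- ax) (by :- ay) (px :- ax) (py :- ay))
               refl ax ay bx by px py s ⟩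
        h ∎
      0<D : 0# < D
      0<D = *-cancelˡ-pos 0<s (<-respʳ (sym sD≈k) 0<k)

    cross⇒meet : 0# < cross F (A ⟶ P) (A ⟶ Q) × 0# < cross F (B ⟶ P) (B ⟶ Q) →
                 Meet A P B Q
    cross⇒meet (0<α , 0<β) =
        at A (k * D⁻¹) P
      , (k * D⁻¹ , *-pos 0<k 0<D⁻¹ , ratio<1 (<-respʳ (sym D-k) 0<β) , refl , refl)
      , (h * D⁻¹ , *-pos 0<h 0<D⁻¹ , ratio<1 (<-respʳ (sym D-h) 0<α) , same-x , same-y)
      where
      0<D : 0# < D
      0<D = <-respʳ (solve 2 (λ d h → (d :- h) :+ h := d) refl D h)
              (+-nonneg-pos (inj₁ (<-respʳ (sym D-h) 0<α)) 0<h)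
      D-invertible = inverse D (λ D≈0 → <-irrefl (sym D≈0) 0<D)
      D⁻¹ = proj₁ D-invertible
      DD⁻¹≈1 : D * D⁻¹ ≈ 1#
      DD⁻¹≈1 = proj₂ D-invertible
      0<D⁻¹ : 0# < D⁻¹
      0<D⁻¹ = inverse-pos 0<D DD⁻¹≈1
      ratio<1 : ∀ {z} → 0# < D - z → z * D⁻¹ < 1#
      ratio<1 {z} 0<D-z = 0<y-x⇒x<y (<-respʳ
        (trans (solve 3 (λ d z i → (d :- z) :* i := d :* i :- z :* i) refl D z D⁻¹) (+-congʳ DD⁻¹≈1))
        (*-pos 0<D-z 0<D⁻¹))
      -- Cramer's rule: k AP - h BQ = D AB.
      same : ∀ {x y p q} → k * (p - x) - h * (q - y) ≈ D * (y - x) →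
             x + (k * D⁻¹) * (p - x) ≈ y + (h * D⁻¹) * (q - y)
      same {x} {y} {p} {q} cramer = begin
        x + (k * D⁻¹) * (p - x)
          ≈⟨ solve 7 (λ x y p q k h i →
               x :+ (k :* i) :* (p :- x)
                 := x :+ (i :* (k :* (p :- x) :- h :* (q :- y)) :+ (h :* i) :* (q :- y)))
               refl x y p q k h D⁻¹ ⟩
        x + (D⁻¹ * (k * (p - x) - h * (q - y)) + (h * D⁻¹) * (q - y))
          ≈⟨ +-congˡ (+-congʳ (*-congˡ cramer)) ⟩
        x + (D⁻¹ * (D * (y - x)) + (h * D⁻¹) * (q - y))
          ≈⟨ solve 5 (λ x y d i z →
               x :+ (i :* (d :* (y :- x)) :+ z) := x :+ ((d :* i) :* (y :- x) :+ z))
               refl x y D D⁻¹ ((h * D⁻¹) * (q - y)) ⟩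
        x + ((D * D⁻¹) * (y - x) + (h * D⁻¹) * (q - y))
          ≈⟨ +-congˡ (+-congʳ (*-congʳ DD⁻¹≈1)) ⟩
        x + (1# * (y - x) + (h * D⁻¹) * (q - y))
          ≈⟨ solve 3 (λ x y z → x :+ (con (+ 1) :* (y :- x) :+ z) := y :+ z)
               refl x y ((h * D⁻¹) * (q - y)) ⟩
        y + (h * D⁻¹) * (q - y) ∎
      same-x : ax + (k * D⁻¹) * (px - ax) ≈ bx + (h * D⁻¹) * (qx - bx)
      same-x = same (solve 8 (λ ax ay bx by px py qx qy →
        :cross (bx :- ax) (by :- ay) (qx :- ax) (qy :- ay) :* (px :- ax)
          :- :cross (bx :- ax) (by :- ay) (px :- ax) (py :- ay) :* (qx :- bx)
          := :cross (px :- ax) (py :- ay) (qx :- bx) (qy :- by) :* (bx :- ax))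
        refl ax ay bx by px py qx qy)
      same-y : ay + (k * D⁻¹) * (py - ay) ≈ by + (h * D⁻¹) * (qy - by)
      same-y = same (solve 8 (λ ax ay bx by px py qx qy →
        :cross (bx :- ax) (by :- ay) (qx :- ax) (qy :- ay) :* (py :- ay)
          :- :cross (bx :- ax) (by :- ay) (px :- ax) (py :- ay) :* (qy :- by)
          := :cross (px :- ax) (py :- ay) (qx :- bx) (qy :- by) :* (by :- ay))
        refl ax ay bx by px py qx qy)

  AnglesInterlace : (A P B Q : Point F) → Set ℓ₂
  AnglesInterlace A P B Q =
    _<∠_ F (∠ F B A P) (∠ F B A Q) × _<∠_ F (∠ F A B Q) (∠ F A B P)

  -- What lies to the left of AB lies to the right of BA, so the angles at A fall under
  -- `angle-<-left` and those at B under `angle-<-right`. This is why the two angular orders are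
  -- opposite.
  meet-angles-left : ∀ {A P B Q} → InHalfPlane F left A B P → InHalfPlane F left A B Q →
                     Meet A P B Q ⇔ AnglesInterlace A P B Q
  meet-angles-left {A} {P} {B} {Q} P∈left Q∈left = mk⇔
    (λ meet → let 0<α , 0<β = to (meet-cross P∈left Q∈left) meet in
      from angle-A 0<α , from angle-B 0<β)
    (λ (α , β) → from (meet-cross P∈left Q∈left) (to angle-A α , to angle-B β))
    where
    angle-A = angle-<-left P∈left Q∈left
    angle-B = angle-<-right (reverse-half-plane left {A} {B} {Q} Q∈left)
                            (reverse-half-plane left {A} {B} {P} P∈left)

  -- Exchanging A with B and P with Q turns the right half-plane into the left one and exchanges the
  -- two conditions of `AnglesInterlace`.
  meet-angles : ∀ side {A P B Q} → InHalfPlane F side A B P → InHalfPlane F side A B Q →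
                Meet A P B Q ⇔ AnglesInterlace A P B Q
  meet-angles left  P∈left  Q∈left  = meet-angles-left P∈left Q∈left
  meet-angles right {A} {P} {B} {Q} P∈right Q∈right = mk⇔
    (λ meet → let β , α = to reversed (Meet-swap meet) in α , β)
    (λ (α , β) → Meet-swap (from reversed (β , α)))
    where
    reversed = meet-angles-left (reverse-half-plane right {A} {B} {Q} Q∈right)
                                (reverse-half-plane right {A} {B} {P} P∈right)

  -- Segments that cannot cross.

  interior-half-plane : ∀ side {A B P X} → InteriorPoint F A P X →
                        InHalfPlane F side A B P → InHalfPlane F side A B X
  interior-half-plane side {A} {B} {P} {X} (s , 0<s , _ , X≈) =
    half-plane-scale side {A} {B} {P} {X} 0<s X≈

  half-planes-disjoint : ∀ {side side′ A B P} → ¬ side ≡ side′ →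
                         InHalfPlane F side A B P → ¬ InHalfPlane F side′ A B P
  half-planes-disjoint {left}  {left}  l≢l = contradiction ≡.refl l≢l
  half-planes-disjoint {left}  {right} _   = <-asym
  half-planes-disjoint {right} {left}  _   = <-asym
  half-planes-disjoint {right} {right} r≢r = contradiction ≡.refl r≢r

  -- A common interior point would lie on the side of P and also on that of Q. Since BQ starts at B,
  -- its side is read off the line BA, where the two sides are exchanged.
  different-sides-disjoint : ∀ {side side′ A P B Q} → ¬ side ≡ side′ →
    InHalfPlane F side A B P → InHalfPlane F side′ A B Q → ¬ Meet A P B Q
  different-sides-disjoint {side} {side′} {A} {P} {B} {Q} side≢side′ P∈ Q∈ (X , X∈AP , X∈BQ) =
    half-planes-disjoint {opposite side} {opposite side′} {B} {A} {X}
      (side≢side′ ∘ opposite-injective)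
      (reverse-half-plane side {A} {B} {X} (interior-half-plane side {A} {B} {P} {X} X∈AP P∈))
      (interior-half-plane (opposite side′) {B} {A} {Q} {X} X∈BQ
        (reverse-half-plane side′ {A} {B} {Q} Q∈))

  -- A common interior point gives s AP = r AQ with `s` invertible, so P lies on the line AQ, at
  -- parameter `s⁻¹ * r`.
  common-endpoint-collinear : ∀ {A P Q X} → ¬ _≈ₚ_ F Q A →
    InteriorPoint F A P X → InteriorPoint F A Q X → Collinear F A P Q
  common-endpoint-collinear {A} {P} {Q} {X} Q≉A (s , 0<s , _ , X≈s) (r , _ , _ , X≈r) =
      A , A ⟶ Q
    , (λ (x≈0 , y≈0) → Q≉A (x∙y⁻¹≈ε⇒x≈y _ _ x≈0 , x∙y⁻¹≈ε⇒x≈y _ _ y≈0))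
    , (0# , sym (proj₁ A≈) , sym (proj₂ A≈))
    , (s⁻¹ * r , coordinate (trans (sym (proj₁ X≈s)) (proj₁ X≈r))
               , coordinate (trans (sym (proj₂ X≈s)) (proj₂ X≈r)))
    , (1# , one _ _ , one _ _)
    where
    A≈ = at-zero A Q refl
    s-invertible = inverse s (λ s≈0 → <-irrefl (sym s≈0) 0<s)
    s⁻¹ = proj₁ s-invertible
    coordinate : ∀ {x p q} → x + s * (p - x) ≈ x + r * (q - x) →
                 p ≈ x + (s⁻¹ * r) * (q - x)
    coordinate {x} {p} {q} eq = begin
      p
        ≈⟨ solve 2 (λ x p → p := x :+ con (+ 1) :* (p :- x)) refl x p ⟩
      x + 1# * (p - x)
        ≈⟨ +-congˡ (*-congʳ (proj₂ s-invertible)) ⟨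
      x + (s * s⁻¹) * (p - x)
        ≈⟨ solve 4 (λ x p s i →
             x :+ (s :* i) :* (p :- x) := x :+ i :* ((x :+ s :* (p :- x)) :- x)) refl x p s s⁻¹ ⟩
      x + s⁻¹ * ((x + s * (p - x)) - x)
        ≈⟨ +-congˡ (*-congˡ (+-congʳ eq)) ⟩
      x + s⁻¹ * ((x + r * (q - x)) - x)
        ≈⟨ solve 4 (λ x q r i →
             x :+ i :* ((x :+ r :* (q :- x)) :- x) := x :+ (i :* r) :* (q :- x)) refl x q r s⁻¹ ⟩
      x + (s⁻¹ * r) * (q - x) ∎
    one : ∀ x q → q ≈ x + 1# * (q - x)
    one = solve 2 (λ x q → q := x :+ con (+ 1) :* (q :- x)) refl

-- Edges of the graph and the renaming of its vertices.

relabelMid : ∀ {n} → (Fin n → Fin n) → K₂-Vertex n → K₂-Vertex n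
relabelMid f a       = a
relabelMid f b       = b
relabelMid f (mid i) = mid (f i)

relabelMid-inverse : ∀ {n} {f g : Fin n → Fin n} → (∀ i → f (g i) ≡ i) →
                     ∀ x → relabelMid f (relabelMid g x) ≡ x
relabelMid-inverse fg≡id a       = ≡.refl
relabelMid-inverse fg≡id b       = ≡.refl
relabelMid-inverse fg≡id (mid i) = ≡.cong mid (fg≡id i)

relabelMid-adj : ∀ {n} (f : Fin n → Fin n) {x y} →
                 K₂-Adj x y → K₂-Adj (relabelMid f x) (relabelMid f y)
relabelMid-adj f (a–mid i) = a–mid (f i)
relabelMid-adj f (b–mid i) = b–mid (f i)
relabelMid-adj f (mid–a i) = mid–a (f i)
relabelMid-adj f (mid–b i) = mid–b (f i)

-- An edge may be written from either end; symmetry of `P` leaves only the orientations that start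
-- at `a` or `b`.
edge-cases : ∀ {n p} (P : K₂-Vertex n → K₂-Vertex n → Set p) →
             (∀ {x y} → P x y → P y x) →
             (∀ i → P a (mid i)) → (∀ i → P b (mid i)) →
             ∀ {x y} → K₂-Adj x y → P x y
edge-cases P P-sym Pa Pb (a–mid i) = Pa i
edge-cases P P-sym Pa Pb (b–mid i) = Pb i
edge-cases P P-sym Pa Pb (mid–a i) = P-sym (Pa i)
edge-cases P P-sym Pa Pb (mid–b i) = P-sym (Pb i)

-- Reduction of geo-isomorphism to crossings of edges at `a` with edges at `b`.

module K₂-Realizations {c ℓ₁ ℓ₂} (F : OrderedField c ℓ₁ ℓ₂) where
  open PlaneGeometry F
  open Realization

  private variable
    n : ℕ
    x y u v : K₂-Vertex n

  flipˡ : (K̄ : Realization F (K₂ n)) → Crosses K̄ x y u v → Crosses K̄ y x u v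
  flipˡ {n} K̄ (xy , uv , distinct , X , X∈xy , X∈uv) =
    SimpleGraph.sym (K₂ n) xy , uv
    , (λ { (inj₁ (y≡u , x≡v)) → distinct (inj₂ (x≡v , y≡u))
         ; (inj₂ (y≡v , x≡u)) → distinct (inj₁ (x≡u , y≡v)) })
    , X , interior-reverse X∈xy , X∈uv

  swap : (K̄ : Realization F (K₂ n)) → Crosses K̄ x y u v → Crosses K̄ u v x y
  swap K̄ (xy , uv , distinct , X , X∈xy , X∈uv) =
    uv , xy
    , (λ { (inj₁ (u≡x , v≡y)) → distinct (inj₁ (≡.sym u≡x , ≡.sym v≡y))
         ; (inj₂ (u≡y , v≡x)) → distinct (inj₂ (≡.sym v≡x , ≡.sym u≡y)) })
    , X , X∈uv , X∈xy

  flipʳ : (K̄ : Realization F (K₂ n)) → Crosses K̄ x y u v → Crosses K̄ x y v u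
  flipʳ K̄ = swap K̄ ∘ flipˡ K̄ ∘ swap K̄

  -- If the interiors met, the three endpoints would be collinear, against general position; they
  -- are three different vertices because the edges are distinct.
  adjacent-edges-disjoint : (K̄ : Realization F (K₂ n)) →
    ¬ u ≡ x → ¬ u ≡ y → ¬ Crosses K̄ u x u y
  adjacent-edges-disjoint {u = u} {x = x} {y = y} K̄ u≢x u≢y
    (_ , _ , distinct , X , X∈ux , X∈uy) =
    noCollinear K̄ u≢x (λ x≡y → distinct (inj₁ (≡.refl , x≡y))) u≢y
      (common-endpoint-collinear (λ y≈u → u≢y (≡.sym (injective K̄ y≈u))) X∈ux X∈uy)

  MidsCross : Realization F (K₂ n) → Fin n → Fin n → Set _
  MidsCross K̄ i j = Meet (pos K̄ a) (pos K̄ (mid i)) (pos K̄ b) (pos K̄ (mid j))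

  module _ (K̄ H̄ : Realization F (K₂ n)) (f : Fin n → Fin n)
           (mids-cross : ∀ i j → MidsCross K̄ i j → MidsCross H̄ (f i) (f j)) where

    private
      g = relabelMid f

      ab-cross : ∀ i j → Crosses K̄ a (mid i) b (mid j) →
                 Crosses H̄ a (mid (f i)) b (mid (f j))
      ab-cross i j (_ , _ , _ , meet) =
        a–mid (f i) , b–mid (f j) , (λ { (inj₁ (() , _)) ; (inj₂ (() , _)) }) ,
        mids-cross i j meet

      Transfers : (x y u v : K₂-Vertex n) → Set _
      Transfers x y u v = Crosses K̄ x y u v → Crosses H̄ (g x) (g y) (g u) (g v)

      transfer : K₂-Adj x y → K₂-Adj u v → Transfers x y u v
      transfer xy uv = edge-cases (λ x y → Transfers x y _ _)
        (λ cross → flipˡ H̄ ∘ cross ∘ flipˡ K̄)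
        (λ i → edge-cases (Transfers a (mid i)) (λ cross → flipʳ H̄ ∘ cross ∘ flipʳ K̄)
          (λ j → ⊥-elim ∘ adjacent-edges-disjoint K̄ (λ ()) (λ ()))
          (λ j → ab-cross i j) uv)
        (λ i → edge-cases (Transfers b (mid i)) (λ cross → flipʳ H̄ ∘ cross ∘ flipʳ K̄)
          (λ j → swap H̄ ∘ ab-cross j i ∘ swap K̄)
          (λ j → ⊥-elim ∘ adjacent-edges-disjoint K̄ (λ ()) (λ ())) uv)
        xy

    -- Two edges at `a`, or two at `b`, never cross. Up to order and orientation every crossing
    -- therefore joins an edge at `a` and an edge at `b`, which is what `mids-cross` handles; the
    -- pair `i ≡ j`, with common end `mid i`, is included there.
    crosses-relabel : Crosses K̄ x y u v → Crosses H̄ (g x) (g y) (g u) (g v)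
    crosses-relabel crosses@(xy , uv , _) = transfer xy uv crosses

  mids-cross⇒geoIsomorphism : (K̄ H̄ : Realization F (K₂ n)) (ρ : Permutation′ n) →
    (∀ i j → MidsCross K̄ (ρ ⟨$⟩ʳ i) (ρ ⟨$⟩ʳ j) ⇔ MidsCross H̄ i j) →
    GeoIsomorphism F K̄ H̄
  mids-cross⇒geoIsomorphism K̄ H̄ ρ mids-cross = record
    -- `ρ` takes the labels of `H̄` to those of `K̄`, so the map from `K̄` to `H̄` applies its
    -- inverse.
    { bijection = ↔⇒⤖ (mk↔ₛ′ g g⁻¹ gg⁻¹ g⁻¹g)
    ; adjacency = λ x y → mk⇔ (relabelMid-adj (ρ ⟨$⟩ˡ_))
        (λ adj → ≡.subst₂ K₂-Adj (g⁻¹g x) (g⁻¹g y) (relabelMid-adj (ρ ⟨$⟩ʳ_) adj))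
    ; crossings = λ x y u v → mk⇔
        (crosses-relabel K̄ H̄ (ρ ⟨$⟩ˡ_) λ i j →
          to (mids-cross (ρ ⟨$⟩ˡ i) (ρ ⟨$⟩ˡ j)) ∘ ≡.subst₂ (MidsCross K̄) (≡.sym (inverseʳ ρ)) (≡.sym (inverseʳ ρ)))
        (λ crosses → subst₄ (g⁻¹g x) (g⁻¹g y) (g⁻¹g u) (g⁻¹g v)
          (crosses-relabel H̄ K̄ (ρ ⟨$⟩ʳ_) (λ i j → from (mids-cross i j)) crosses))
    }
    where
    g   = relabelMid (ρ ⟨$⟩ˡ_)
    g⁻¹ = relabelMid (ρ ⟨$⟩ʳ_)
    gg⁻¹ : ∀ x → g (g⁻¹ x) ≡ x
    gg⁻¹ = relabelMid-inverse (λ _ → inverseˡ ρ)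
    g⁻¹g : ∀ x → g⁻¹ (g x) ≡ x
    g⁻¹g = relabelMid-inverse (λ _ → inverseʳ ρ)
    subst₄ : ∀ {x x′ y y′ u u′ v v′} → x ≡ x′ → y ≡ y′ → u ≡ u′ → v ≡ v′ →
             Crosses K̄ x y u v → Crosses K̄ x′ y′ u′ v′
    subst₄ ≡.refl ≡.refl ≡.refl ≡.refl crosses = crosses

  -- Angular orders and inversions of the permutation.

  -- By trichotomy of the labels. Monotonicity is asked for the given pair only, since in the
  -- protocol it holds just within one half-plane.
  order-reflects : ∀ (θ : Fin n → Angle F) {i j} →
    (i Fin.< j → _<∠_ F (θ i) (θ j)) → (j Fin.< i → _<∠_ F (θ j) (θ i)) →
    _<∠_ F (θ i) (θ j) → i Fin.< j
  order-reflects θ {i} {j} mono mono′ θi<θj with Fin.<-cmp i j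
  ... | tri< i<j _ _    = i<j
  ... | tri≈ _ ≡.refl _ = contradiction θi<θj <∠-irrefl
  ... | tri> _ _ j<i    = contradiction (mono′ j<i) (<∠-asym θi<θj)

  module _ (π : Permutation′ n) where

    private
      π⁻¹ : Fin n → Fin n
      π⁻¹ = π ⟨$⟩ˡ_

    -- `π` lists the labels in the order of angles at `a`, so `π⁻¹ i` is the position of `i` in that
    -- order. The relation is directed: it concerns the edges a-i and b-j, not a-j and b-i, and it
    -- is empty for `i ≡ j`.
    Inversion : Fin n → Fin n → Set
    Inversion i j = π⁻¹ i Fin.< π⁻¹ j × j Fin.< i

    MonotoneOn : (Fin n → Set) → (Fin n → Angle F) → Set _
    MonotoneOn C θ = ∀ {i j} → C i → C j → i Fin.< j → _<∠_ F (θ i) (θ j)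

    -- Within `C`, the order of angles at A is the order of positions and the order of angles at B
    -- is the order of labels. `C` is everything for the realization of `π`, and one half-plane at a
    -- time for the protocol.
    interlace⇔inversion : ∀ {A B} {P : Fin n → Point F} {C : Fin n → Set} →
      MonotoneOn (C ∘ (π ⟨$⟩ʳ_)) (λ i → ∠ F B A (P (π ⟨$⟩ʳ i))) →
      MonotoneOn C (λ i → ∠ F A B (P i)) →
      ∀ {i j} → C i → C j → AnglesInterlace A (P i) B (P j) ⇔ Inversion i j
    interlace⇔inversion {A} {B} {P} {C} α-mono β-mono {i} {j} i∈C j∈C = mk⇔
      (λ (αi<αj , βj<βi) →
          order-reflects (λ k → ∠ F B A (P (π ⟨$⟩ʳ k))) (α-mono i∈C′ j∈C′) (α-mono j∈C′ i∈C′)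
            (≡.subst₂ α-<  (≡.sym (inverseʳ π)) (≡.sym (inverseʳ π)) αi<αj)
        , order-reflects (λ k → ∠ F A B (P k)) (β-mono j∈C i∈C) (β-mono i∈C j∈C) βj<βi)
      (λ (i<′j , j<i) →
          ≡.subst₂ α-< (inverseʳ π) (inverseʳ π) (α-mono i∈C′ j∈C′ i<′j)
        , β-mono j∈C i∈C j<i)
      where
      α-< : Fin n → Fin n → Set _
      α-< k l = _<∠_ F (∠ F B A (P k)) (∠ F B A (P l))
      i∈C′ = ≡.subst C (≡.sym (inverseʳ π)) i∈C
      j∈C′ = ≡.subst C (≡.sym (inverseʳ π)) j∈C

    realization-crossing : (K̄ : Realization F (K₂ n)) → IsRealizationOf F π K̄ →
                           ∀ i j → MidsCross K̄ i j ⇔ Inversion i j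
    realization-crossing K̄ R i j = ⇔.trans
      (meet-angles side {A} {P i} {B} {P j} (P∈side i) (P∈side j))
      (interlace⇔inversion {P = P} {C = λ _ → ⊤} (λ _ _ → α-mono) (λ _ _ → β-mono) _ _)
      where
      open IsRealizationOf R
      A = pos K̄ a
      B = pos K̄ b
      P : Fin n → Point F
      P k = pos K̄ (mid k)
      -- Needed to exclude the ray parameter 0.
      P≉A : ∀ k → ¬ _≈ₚ_ F (P k) A
      P≉A k eq = contradiction (injective K̄ eq) λ ()
      P≉B : ∀ k → ¬ _≈ₚ_ F (P k) B
      P≉B k eq = contradiction (injective K̄ eq) λ ()
      P∈side : ∀ k → InHalfPlane F side A B (P k)
      P∈side k = ray-half-plane side (P≉A k) (proj₁ (vertex k)) (sideᵃ k)
      α-mono : ∀ {k l} → k Fin.< l →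
               _<∠_ F (∠ F B A (P (π ⟨$⟩ʳ k))) (∠ F B A (P (π ⟨$⟩ʳ l)))
      α-mono k<l = ray-angle-< (A ⟶ B) (P≉A _) (P≉A _)
        (proj₁ (vertex _)) (proj₁ (vertex _)) (increasingᵃ k<l)
      β-mono : ∀ {k l} → k Fin.< l → _<∠_ F (∠ F A B (P k)) (∠ F A B (P l))
      β-mono k<l = ray-angle-< (B ⟶ A) (P≉B _) (P≉B _)
        (proj₂ (vertex _)) (proj₂ (vertex _)) (increasingᵇ k<l)

    -- Vertices on different sides never cross, and they form no inversion
    -- because both π and the labels list the chosen side first.
    protocol-crossing : (K̄ : Realization F (K₂ n)) (I : Induces F K̄ π) →
      let open Induces I in
      ∀ i j → MidsCross K̄ (relabel ⟨$⟩ʳ i) (relabel ⟨$⟩ʳ j) ⇔ Inversion i j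
    protocol-crossing K̄ I i j = by-side (toℕ i ℕ.<? t) (toℕ j ℕ.<? t)
      where
      open Induces I
      A = pos K̄ a
      B = pos K̄ b
      Chosen Other : Fin n → Set
      Chosen k = toℕ k ℕ.< t
      Other k  = t ℕ.≤ toℕ k
      chosen-π⁻¹ : ∀ {k} → Chosen k → Chosen (π⁻¹ k)
      chosen-π⁻¹ k<t = from (π-chosen _) (≡.subst Chosen (≡.sym (inverseʳ π)) k<t)
      other-π : ∀ {k} → Other (π ⟨$⟩ʳ k) → Other k
      other-π t≤πk = ℕ.≮⇒≥ (λ k<t → ℕ.<⇒≱ (to (π-chosen _) k<t) t≤πk)
      other-π⁻¹ : ∀ {k} → Other k → Other (π⁻¹ k)
      other-π⁻¹ t≤k = other-π (≡.subst Other (≡.sym (inverseʳ π)) t≤k)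
      by-side : Dec (Chosen i) → Dec (Chosen j) →
                MidsCross K̄ (relabel ⟨$⟩ʳ i) (relabel ⟨$⟩ʳ j) ⇔ Inversion i j
      by-side (yes i<t) (yes j<t) = ⇔.trans
        (meet-angles side {A} {newPos i} {B} {newPos j} (chosen i i<t) (chosen j j<t))
        (interlace⇔inversion {P = newPos} {C = Chosen}
          -- `chosenᵃ` bounds the position `l`, whereas `Chosen` bounds the label `π ⟨$⟩ʳ l`;
          -- `π-chosen` converts between the two.
          (λ _ πl<t k<l → chosenᵃ k<l (from (π-chosen _) πl<t))
          (λ _ l<t k<l → chosenᵇ k<l l<t) i<t j<t)
      by-side (no i≮t) (no j≮t) = ⇔.trans
        (meet-angles (opposite side) {A} {newPos i} {B} {newPos j}
          (other i (ℕ.≮⇒≥ i≮t)) (other j (ℕ.≮⇒≥ j≮t)))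
        (interlace⇔inversion {P = newPos} {C = Other}
          (λ t≤πk _ k<l → otherᵃ k<l (other-π t≤πk))
          (λ t≤k _ k<l → otherᵇ k<l t≤k) (ℕ.≮⇒≥ i≮t) (ℕ.≮⇒≥ j≮t))
      by-side (yes i<t) (no j≮t) = mk⇔
        (⊥-elim ∘ different-sides-disjoint {side} {opposite side} {A} {newPos i} {B} {newPos j} (side≢opposite side)
          (chosen i i<t) (other j (ℕ.≮⇒≥ j≮t)))
        (λ (_ , j<i) → contradiction (ℕ.<-trans j<i i<t) j≮t)
      by-side (no i≮t) (yes j<t) = mk⇔
        (⊥-elim ∘ different-sides-disjoint {opposite side} {side} {A} {newPos i} {B} {newPos j}
          (side≢opposite side ∘ ≡.sym) (other i (ℕ.≮⇒≥ i≮t)) (chosen j j<t))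
        (λ (i<′j , _) → contradiction
          (ℕ.<-trans i<′j (chosen-π⁻¹ j<t)) (ℕ.≤⇒≯ (other-π⁻¹ (ℕ.≮⇒≥ i≮t))))

-- Comparison of the two realizations through inversions.

proposition1 : ∀ {c ℓ₁ ℓ₂ : Level} (F : OrderedField c ℓ₁ ℓ₂) (n : ℕ)
    (K̄ : Realization F (K₂ n)) (π : Permutation′ n) →
    Induces F K̄ π →
    (K̄π : Realization F (K₂ n)) → IsRealizationOf F π K̄π →
    GeoIsomorphism F K̄ K̄π
proposition1 F n K̄ π I K̄π R =
  mids-cross⇒geoIsomorphism K̄ K̄π (Induces.relabel I) λ i j →
    ⇔.trans (protocol-crossing π K̄ I i j) (⇔.sym (realization-crossing π K̄π R i j))
  where open K₂-Realizations F
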